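{- For all positive integers $d$ and $k$, there are only finitely many (isomorphism classes of) geometric lattices $L$ of rank $d$ with $|\mu_L(\hat 0,\hat 1)|=k$.
   Context: A geometric lattice is a finite graded lattice with minimum $\hat0$ and maximum $\hat1$ whose rank function is semimodular ($r(x\vee y)+r(x\wedge y)\le r(x)+r(y)$) and which is atomistic (every element is a join of atoms). $\mu_L$ denotes the Möbius function of $L$. -}

module Defs where

open import Level using (0ℓ)
open import Data.Nat using (ℕ; zero; suc; _+_; _≤_)
open import Data.Fin using (Fin)
import Data.Fin
open import Data.List using (List; []; _∷_; foldr; allFin)
open import Data.List.Relation.Unary.All using (All)
open import Data.Integer using (ℤ; -_; 0ℤ; 1ℤ) renaming (_+_ to _+ℤ_)
open import Data.Product using (Σ; _×_; _,_; ∃)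
open import Data.Sum using (_⊎_)
open import Relation.Binary.Core using (Rel)
open import Relation.Binary.Definitions using (Decidable)
open import Relation.Binary.PropositionalEquality using (_≡_; _≢_)
open import Relation.Nullary using (¬_; yes; no)
open import Algebra.Core using (Op₂)
open import Function.Bundles using (_⤖_; Bijection)
import Relation.Binary.Lattice.Structures as LS

-- A finite (bounded) lattice, with carrier Fin size (every finite lattice is
-- isomorphic to one of this form).  Lattice = partial order with binary
-- suprema/infima (stdlib's order-theoretic IsBoundedLattice w.r.t. _≡_).
record FinLattice : Set₁ where
  field
    size      : ℕ
    _≼_       : Rel (Fin size) 0ℓ
    _≼?_      : Decidable _≼_
    _∨_ _∧_   : Op₂ (Fin size)
    𝟙 𝟘       : Fin size
    isBoundedLattice : LS.IsBoundedLattice _≡_ _≼_ _∨_ _∧_ 𝟙 𝟘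

  _≺_ : Rel (Fin size) 0ℓ
  x ≺ y = x ≼ y × x ≢ y

  _⋖_ : Rel (Fin size) 0ℓ
  x ⋖ y = x ≺ y × (∀ z → x ≼ z → z ≼ y → z ≡ x ⊎ z ≡ y)

  IsAtom : Fin size → Set
  IsAtom a = 𝟘 ⋖ a

  ⋁ : List (Fin size) → Fin size
  ⋁ = foldr _∨_ 𝟘

  IsRankFunction : (Fin size → ℕ) → Set
  IsRankFunction r = r 𝟘 ≡ 0 × (∀ x y → x ⋖ y → r y ≡ suc (r x))

  Semimodular : (Fin size → ℕ) → Set
  Semimodular r = ∀ x y → r (x ∨ y) + r (x ∧ y) ≤ r x + r y

  Atomistic : Set
  Atomistic = ∀ x → Σ (List (Fin size)) λ as → All IsAtom as × ⋁ as ≡ x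


  -- Möbius function μ(x , y), via the recursion
  --   μ(x,x) = 1,   μ(x,y) = - Σ_{x ≤ z < y} μ(x,z)   (x < y),   μ(x,y) = 0 otherwise.
  -- The recursion is run with fuel; fuel = size suffices since every chain
  -- in the lattice has fewer than size steps.
  μ-fuel : ℕ → Fin size → Fin size → ℤ
  μ-fuel zero x y = 0ℤ
  μ-fuel (suc f) x y with Data.Fin._≟_ x y
  ... | yes _ = 1ℤ
  ... | no _ with x ≼? y
  ...   | no _ = 0ℤ
  ...   | yes _ = - foldr (λ z acc → term z +ℤ acc) 0ℤ (allFin size)
    where
    term : Fin size → ℤ
    term z with x ≼? z | z ≼? y | Data.Fin._≟_ z y
    ... | yes _ | yes _ | no _ = μ-fuel f x z
    ... | _     | _     | _    = 0ℤ

  μ : Fin size → Fin size → ℤ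
  μ = μ-fuel size

open FinLattice public

record _≅_ (L M : FinLattice) : Set where
  field
    bij : Fin (size L) ⤖ Fin (size M)
    preserves : ∀ x y → _≼_ L x y → _≼_ M (Bijection.to bij x) (Bijection.to bij y)
    reflects  : ∀ x y → _≼_ M (Bijection.to bij x) (Bijection.to bij y) → _≼_ L x y

record IsGeometricOfRank (L : FinLattice) (d : ℕ) : Set where
  field
    rank           : Fin (size L) → ℕ
    isRankFunction : IsRankFunction L rank
    semimodular    : Semimodular L rank
    atomistic      : Atomistic L
    rank-top       : rank (𝟙 L) ≡ d

{-# OPTIONS --safe #-}
-- Fix an atom a below x. Weisner's theorem writes μ(0̂,x) as minus the sum of μ(0̂,z) over the
-- z ≠ x with z ∨ a = x, and semimodularity puts all of these in rank r(x) − 1. By induction on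
-- the rank, (−1)^r(x) μ(0̂,x) is therefore positive and |μ(0̂,x)| is the sum of the |μ(0̂,z)|.
-- Every atom c ≠ a below x lies below one of the z (take z ≥ c maximal in [0̂,x] avoiding a), so
-- if each z has at most (r(x) − 1) |μ(0̂,z)| atoms below it, then x has at most
-- 1 + (r(x) − 1) |μ(0̂,x)| ≤ r(x) |μ(0̂,x)|. Hence L has at most d k atoms and 2^(d k) elements.
module Submission where

open import Defs
open import Algebra.Bundles using (Semiring)
open import Level using (Level)
open import Data.Bool using (Bool; true; false; if_then_else_; T; T?)
open import Data.Nat using (ℕ; zero; suc; _+_; _*_; _^_; _≤_; _<_; z≤n; s≤s; s≤s⁻¹)
import Data.Nat.Properties as ℕ
open import Data.Integer using (ℤ; +_; -_; 0ℤ; 1ℤ; ∣_∣)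
import Data.Integer as ℤ
import Data.Integer.Properties as ℤ
open import Algebra.Properties.AbelianGroup ℤ.+-0-abelianGroup using (inverseˡ-unique)
open import Data.Fin using (Fin; zero; suc; _≟_)
import Data.Fin.Properties as Fin
open import Data.List using (List; []; _∷_; _++_; [_]; allFin; concatMap; filter; foldr; length; map; tabulate; upTo; cartesianProductWith)
import Data.List as List
open import Data.List.Properties using (length-map; length-++)
open import Data.List.Membership.Propositional using (_∈_; lose)
open import Data.List.Membership.Propositional.Properties using (∈-++⁺ˡ; ∈-++⁺ʳ; ∈-allFin; ∈-cartesianProductWith⁺; ∈-filter⁺; ∈-filter⁻; ∈-map⁺; ∈-upTo⁺)
open import Data.List.Relation.Unary.All using (All; []; _∷_)
import Data.List.Relation.Unary.All as All
open import Data.List.Relation.Unary.Any using (Any; here; there; index)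
open import Data.List.Relation.Unary.Any.Properties using (concatMap⁺; lookup-index)
open import Data.Vec using (Vec; []; _∷_; lookup)
import Data.Vec as Vec
open import Data.Vec.Properties using (lookup∘tabulate)
open import Data.Product using (Σ; ∃; _×_; _,_; _,′_; proj₁; proj₂)
open import Data.Sum using (_⊎_; inj₁; inj₂)
open import Function using (_∘_; id; flip; case_of_)
open import Function.Construct.Identity using (⤖-id)
open import Relation.Binary.PropositionalEquality using (_≡_; _≢_; refl; sym; trans; cong; cong₂; subst; isEquivalence; module ≡-Reasoning)
open import Relation.Binary.Lattice.Structures using (module IsBoundedLattice)
open import Relation.Nullary using (¬_; Dec; does; yes; no; contradiction; ¬?)
open import Relation.Nullary.Decidable using (_×-dec_; _⊎-dec_; _→-dec_; ⌊_⌋; toWitness; fromWitness)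

private variable
  p q : Level
  P Q : Set p
  n : ℕ

-- Finite sums restricted to a decidable predicate.

module RestrictedSums {c ℓ} (R : Semiring c ℓ) where
  open Semiring R using (Carrier; _≈_; 0#; zeroʳ; +-identityˡ; +-identityʳ; +-cong; +-congˡ; +-congʳ)
    renaming (refl to ≈-refl; sym to ≈-sym; trans to ≈-trans; _*_ to _·_; _+_ to _⊕_)
  open import Algebra.Properties.Semiring.Sum R public

  -- Zero off the predicate, so that a sum over a subset is a sum over all of `Fin n` and the
  -- general lemmas on sums apply.
  when : Dec P → Carrier → Carrier
  when d x = if does d then x else 0#

  when-yes : (d : Dec P) → P → ∀ x → when d x ≈ x
  when-yes (yes _) _ x = ≈-refl
  when-yes (no ¬p) p x = contradiction p ¬p

  when-no : (d : Dec P) → ¬ P → ∀ x → when d x ≈ 0#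
  when-no (yes p) ¬p x = contradiction p ¬p
  when-no (no _)  _  x = ≈-refl

  when-cong : (d : Dec P) → ∀ {x y} → (P → x ≈ y) → when d x ≈ when d y
  when-cong (yes p) eq = eq p
  when-cong (no _)  eq = ≈-refl

  when-⇔ : (d : Dec P) (e : Dec Q) → (P → Q) → (Q → P) → ∀ x → when d x ≈ when e x
  when-⇔ (yes p) e to from x = ≈-sym (when-yes e (to p) x)
  when-⇔ (no ¬p) e to from x = ≈-sym (when-no e (¬p ∘ from) x)

  when-* : (d : Dec P) → ∀ x y → when d (x · y) ≈ x · when d y
  when-* (yes _) x y = ≈-refl
  when-* (no _)  x y = ≈-sym (zeroʳ x)

  sum-zero : (f : Fin n → Carrier) → (∀ i → f i ≈ 0#) → sum f ≈ 0#
  sum-zero {n} f f≈0 = ≈-trans (sum-cong-≋ {n} f≈0) (sum-replicate-zero n)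

  sum-when : (d : Dec P) (f : Fin n → Carrier) → sum (λ i → when d (f i)) ≈ when d (sum f)
  sum-when (yes _) f = ≈-refl
  sum-when {n = n} (no _) f = sum-zero {n} _ (λ _ → ≈-refl)

  sum-when-* : {P : Fin n → Set p} (P? : ∀ i → Dec (P i)) → ∀ x (f : Fin n → Carrier) →
    sum (λ i → when (P? i) (x · f i)) ≈ x · sum (λ i → when (P? i) (f i))
  sum-when-* {n = n} P? x f =
    ≈-trans (sum-cong-≋ {n} (λ i → when-* (P? i) x (f i))) (≈-sym (*-distribˡ-sum {n} x _))

  sum-single : (f : Fin n → Carrier) (i : Fin n) → (∀ j → j ≢ i → f j ≈ 0#) → sum f ≈ f i
  sum-single f zero    f≈0 =
    ≈-trans (+-congˡ (sum-zero _ (λ j → f≈0 (suc j) λ ()))) (+-identityʳ _)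
  sum-single f (suc i) f≈0 =
    ≈-trans (+-cong (f≈0 zero λ ()) (sum-single (f ∘ suc) i (λ j j≢i → f≈0 (suc j) (j≢i ∘ Fin.suc-injective))))
            (+-identityˡ _)

  -- Holds pointwise, the term at `j` being separated from the rest; it serves to isolate the top of
  -- an interval or of a fibre.
  sum-split : {P : Fin n → Set p} (P? : ∀ i → Dec (P i)) (f : Fin n → Carrier) (j : Fin n) → P j →
    sum (λ i → when (P? i) (f i)) ≈ f j ⊕ sum (λ i → when (P? i ×-dec ¬? (i ≟ j)) (f i))
  sum-split {n} P? f j pj = ≈-trans (sum-cong-≋ {n} split) (≈-trans (∑-distrib-+ {n} _ _) (+-congʳ (≈-trans
      (sum-single {n} _ j (λ i i≢j → when-no (i ≟ j) i≢j _)) (when-yes (j ≟ j) refl _))))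
    where
    split : ∀ i → when (P? i) (f i) ≈ when (i ≟ j) (f i) ⊕ when (P? i ×-dec ¬? (i ≟ j)) (f i)
    split i with P? i | i ≟ j
    ... | yes _ | yes _    = ≈-sym (+-identityʳ _)
    ... | yes _ | no _     = ≈-sym (+-identityˡ _)
    ... | no ¬p | yes refl = contradiction pj ¬p
    ... | no _  | no _     = ≈-sym (+-identityˡ _)

module ∑ℕ = RestrictedSums ℕ.+-*-semiring
module ∑ℤ = RestrictedSums ℤ.+-*-semiring

-- Inequalities for sums of natural numbers, and counting.

sum-mono-≤ : {f g : Fin n → ℕ} → (∀ i → f i ≤ g i) → ∑ℕ.sum f ≤ ∑ℕ.sum g
sum-mono-≤ {zero}  f≤g = z≤n
sum-mono-≤ {suc n} f≤g = ℕ.+-mono-≤ (f≤g zero) (sum-mono-≤ (f≤g ∘ suc))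

sum-mono-< : {f g : Fin n → ℕ} → (∀ i → f i ≤ g i) → ∀ i → f i < g i → ∑ℕ.sum f < ∑ℕ.sum g
sum-mono-< f≤g zero    f<g = ℕ.+-mono-<-≤ f<g (sum-mono-≤ (f≤g ∘ suc))
sum-mono-< f≤g (suc i) f<g = ℕ.+-mono-≤-< (f≤g zero) (sum-mono-< (f≤g ∘ suc) i f<g)

term≤sum : (f : Fin n → ℕ) → ∀ i → f i ≤ ∑ℕ.sum f
term≤sum f zero    = ℕ.m≤m+n _ _
term≤sum f (suc i) = ℕ.≤-trans (term≤sum (f ∘ suc) i) (ℕ.m≤n+m _ _)

pos-sum : (f : Fin n → ℕ) → ∑ℤ.sum (λ i → + f i) ≡ + ∑ℕ.sum f
pos-sum {zero}  f = refl
pos-sum {suc n} f = trans (cong (λ s → (+ f zero) ℤ.+ s) (pos-sum (f ∘ suc))) (sym (ℤ.pos-+ (f zero) _))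

pos-when : (d : Dec P) (m : ℕ) → ∑ℤ.when d (+ m) ≡ + ∑ℕ.when d m
pos-when (yes _) m = refl
pos-when (no _)  m = refl

when-mono-≤ : (d : Dec P) {k m : ℕ} → (P → k ≤ m) → ∑ℕ.when d k ≤ ∑ℕ.when d m
when-mono-≤ (yes p) k≤m = k≤m p
when-mono-≤ (no _)  k≤m = z≤n

count : {P : Fin n → Set p} → (∀ i → Dec (P i)) → ℕ
count P? = ∑ℕ.sum (λ i → ∑ℕ.when (P? i) 1)

when-⇒ : (d : Dec P) (e : Dec Q) → (P → Q) → ∑ℕ.when d 1 ≤ ∑ℕ.when e 1
when-⇒ (no _)  e       P⇒Q = z≤n
when-⇒ (yes p) (yes _) P⇒Q = ℕ.≤-refl
when-⇒ (yes p) (no ¬q) P⇒Q = contradiction (P⇒Q p) ¬q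

count-< : {P : Fin n → Set p} {Q : Fin n → Set q} (P? : ∀ i → Dec (P i)) (Q? : ∀ i → Dec (Q i)) →
  (∀ i → P i → Q i) → ∀ i → ¬ P i → Q i → count P? < count Q?
count-< P? Q? P⇒Q i ¬p q = sum-mono-< (λ j → when-⇒ (P? j) (Q? j) (P⇒Q j)) i strict
  where
  strict : ∑ℕ.when (P? i) 1 < ∑ℕ.when (Q? i) 1
  strict rewrite ∑ℕ.when-no (P? i) ¬p 1 | ∑ℕ.when-yes (Q? i) q 1 = s≤s z≤n

count-<-size : {P : Fin n → Set p} (P? : ∀ i → Dec (P i)) → ∀ i → ¬ P i → count P? < n
count-<-size {n} P? i ¬p =
  -- `P?` is compared with an always true predicate, here `n ≡ n`, whose count is `n`.
  subst (count P? <_) (sum-one n) (count-< P? (λ _ → yes refl) (λ _ _ → refl {x = n}) i ¬p refl)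
  where
  sum-one : ∀ m → ∑ℕ.sum {m} (λ _ → 1) ≡ m
  sum-one zero    = refl
  sum-one (suc m) = cong suc (sum-one m)

length-filter-tabulate : {A : Set} {P : A → Set} (P? : ∀ x → Dec (P x)) (g : Fin n → A) →
  length (filter P? (tabulate g)) ≡ count (P? ∘ g)
length-filter-tabulate {zero}  P? g = refl
length-filter-tabulate {suc n} P? g with P? (g zero)
... | yes _ = cong suc (length-filter-tabulate P? (g ∘ suc))
... | no _  = length-filter-tabulate P? (g ∘ suc)

-- The folded function `c` is known only through its values, so the summand local to `μ-fuel` can be
-- treated without a name.
foldr-tabulate : {A : Set} {c : A → ℤ → ℤ} (f : A → ℤ) (g : Fin n → A) →
  (∀ x acc → c x acc ≡ f x ℤ.+ acc) → foldr c 0ℤ (tabulate g) ≡ ∑ℤ.sum (f ∘ g)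
foldr-tabulate {zero}  f g eq = refl
foldr-tabulate {suc n} f g eq =
  trans (eq (g zero) _) (cong (λ s → f (g zero) ℤ.+ s) (foldr-tabulate f (g ∘ suc) eq))

-- Choosing a position in `xs` for each `i` is injective, since the entry at that position recovers
-- `i`.
covered⇒≤length : (xs : List (Fin n)) → (∀ i → i ∈ xs) → n ≤ length xs
covered⇒≤length xs i∈xs = Fin.injective⇒≤ {f = λ i → index (i∈xs i)} λ {i} {j} eq →
  trans (lookup-index (i∈xs i)) (trans (cong (List.lookup xs) eq) (sym (lookup-index (i∈xs j))))

-- The Möbius function of a finite lattice, freed from fuel.

module FiniteLattice (L : FinLattice) where
  open FinLattice L using ()
    renaming (size to N; _≼_ to _⊑_; _≼?_ to _⊑?_; _∨_ to _⊔_; 𝟙 to 1̂; 𝟘 to 0̂; _≺_ to _⊏_)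
  open IsBoundedLattice (isBoundedLattice L) using (x≤x∨y; y≤x∨y; ∨-least; antisym; minimum; maximum)
    renaming (refl to ⊑-refl; trans to ⊑-trans)

  _⊏?_ : ∀ x y → Dec (x ⊏ y)
  x ⊏? y = (x ⊑? y) ×-dec ¬? (x ≟ y)

  μ-fuel-refl : ∀ f x → μ-fuel L (suc f) x x ≡ 1ℤ
  μ-fuel-refl f x with x ≟ x
  ... | yes _   = refl
  ... | no x≢x  = contradiction refl x≢x

  mutual
    -- Sharing a block with `μ-fuel-term` lets the call below fix the summand left blank there.
    μ-fuel-step : ∀ f x y → x ≢ y → x ⊑ y →
      μ-fuel L (suc f) x y ≡ - ∑ℤ.sum (λ z → ∑ℤ.when ((x ⊑? z) ×-dec (z ⊏? y)) (μ-fuel L f x z))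
    μ-fuel-step f x y x≢y x⊑y with x ≟ y
    ... | yes x≡y = contradiction x≡y x≢y
    ... | no ¬eq with x ⊑? y
    ...   | no x⋢y = contradiction x⊑y x⋢y
    ...   | yes le  =
      cong -_ (foldr-tabulate {N} _ id (μ-fuel-term f x y ¬eq le))

    -- The omitted left-hand side is the summand of `μ-fuel`, a local function that cannot be named here.
    μ-fuel-term : ∀ f x y (x≢y : x ≢ y) (x⊑y : x ⊑ y) z acc →
      _ ≡ ∑ℤ.when ((x ⊑? z) ×-dec (z ⊏? y)) (μ-fuel L f x z) ℤ.+ acc
    μ-fuel-term f x y _ _ z _ with x ⊑? z | z ⊑? y | z ≟ y
    ... | yes _ | yes _ | no _  = refl
    ... | yes _ | yes _ | yes _ = refl
    ... | yes _ | no _  | yes _ = refl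
    ... | yes _ | no _  | no _  = refl
    ... | no _  | yes _ | yes _ = refl
    ... | no _  | yes _ | no _  = refl
    ... | no _  | no _  | yes _ = refl
    ... | no _  | no _  | no _  = refl

  ⊏-trans : ∀ {x y z} → x ⊏ y → y ⊏ z → x ⊏ z
  ⊏-trans (x⊑y , x≢y) (y⊑z , _) =
    ⊑-trans x⊑y y⊑z , λ { refl → x≢y (antisym x⊑y y⊑z) }

  -- The number of elements strictly below, not a chain length: strictly monotone and less than `N`,
  -- it measures termination before any rank is available.
  height : Fin N → ℕ
  height y = count (_⊏? y)

  height-< : ∀ {x y} → x ⊏ y → height x < height y
  height-< {x} {y} x⊏y =
    count-< (_⊏? x) (_⊏? y) (λ _ z⊏x → ⊏-trans z⊏x x⊏y) x (λ x⊏x → proj₂ x⊏x refl) x⊏y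

  height<size : ∀ y → height y < N
  height<size y = count-<-size (_⊏? y) y (λ y⊏y → proj₂ y⊏y refl)

  -- Each recursive call uses one unit of fuel and lowers the height by at least one, so fuel
  -- exceeding the height never runs out.
  μ-fuel-stable : ∀ f g y → height y < f → height y < g → μ-fuel L f 0̂ y ≡ μ-fuel L g 0̂ y
  μ-fuel-stable (suc f) (suc g) y hf hg = case 0̂ ≟ y of λ where
    (yes refl) → trans (μ-fuel-refl f 0̂) (sym (μ-fuel-refl g 0̂))
    (no 0≢y) → trans (μ-fuel-step f 0̂ y 0≢y (minimum y)) (trans
      (cong -_ (∑ℤ.sum-cong-≋ {N} λ z → ∑ℤ.when-cong ((0̂ ⊑? z) ×-dec (z ⊏? y)) λ (_ , z⊏y) →
        μ-fuel-stable f g z (ℕ.<-≤-trans (height-< z⊏y) (s≤s⁻¹ hf)) (ℕ.<-≤-trans (height-< z⊏y) (s≤s⁻¹ hg))))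
      (sym (μ-fuel-step g 0̂ y 0≢y (minimum y))))

  μ₀ : Fin N → ℤ
  μ₀ = μ L 0̂

  μ₀-0̂ : μ₀ 0̂ ≡ 1ℤ
  μ₀-0̂ = go N (height<size 0̂)
    where
    -- Stated for any fuel because `N` is not visibly a successor; the height bound excludes zero.
    go : ∀ f → height 0̂ < f → μ-fuel L f 0̂ 0̂ ≡ 1ℤ
    go (suc f) _ = μ-fuel-refl f 0̂

  μ₀-recursion : ∀ y → 0̂ ≢ y → μ₀ y ≡ - ∑ℤ.sum (λ z → ∑ℤ.when (z ⊏? y) (μ₀ z))
  μ₀-recursion y 0≢y = go N (height<size y)
    where
    go : ∀ f → height y < f → μ-fuel L f 0̂ y ≡ - ∑ℤ.sum (λ z → ∑ℤ.when (z ⊏? y) (μ₀ z))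
    go (suc f) h = trans (μ-fuel-step f 0̂ y 0≢y (minimum y)) (cong -_ (∑ℤ.sum-cong-≋ {N} λ z → trans
      -- The test `0̂ ⊑ z` always succeeds, and stability replaces the remaining fuel `f` by `N`.
      (∑ℤ.when-⇔ ((0̂ ⊑? z) ×-dec (z ⊏? y)) (z ⊏? y) proj₂ (minimum z ,_) _)
      (∑ℤ.when-cong (z ⊏? y) λ z⊏y →
        μ-fuel-stable f N z (ℕ.<-≤-trans (height-< z⊏y) (s≤s⁻¹ h)) (height<size z))))

  sum-μ₀-below : ∀ y → 0̂ ≢ y → ∑ℤ.sum (λ z → ∑ℤ.when (z ⊑? y) (μ₀ z)) ≡ 0ℤ
  sum-μ₀-below y 0≢y = begin
    ∑ℤ.sum (λ z → ∑ℤ.when (z ⊑? y) (μ₀ z)) ≡⟨ ∑ℤ.sum-split {N} (_⊑? y) μ₀ y ⊑-refl ⟩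
    μ₀ y ℤ.+ below                         ≡⟨ cong (λ s → s ℤ.+ below) (μ₀-recursion y 0≢y) ⟩
    - below ℤ.+ below                      ≡⟨ ℤ.+-inverseˡ below ⟩
    0ℤ                                     ∎
    where
    open ≡-Reasoning
    below = ∑ℤ.sum (λ z → ∑ℤ.when (z ⊏? y) (μ₀ z))

  -- Weisner's theorem.

  module _ (a : Fin N) (0≢a : 0̂ ≢ a) where

    fibreSum : Fin N → ℤ
    fibreSum x = ∑ℤ.sum (λ z → ∑ℤ.when ((z ⊔ a) ≟ x) (μ₀ z))

    -- The fibres of z ↦ z ∨ a over [a , x] partition [0̂ , x], where μ(0̂ , –) sums to zero.
    weisner : ∀ x → a ⊑ x → fibreSum x ≡ 0ℤ
    weisner x = go (suc (height x)) x (ℕ.n<1+n _)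
      where
      open ≡-Reasoning
      go : ∀ f x → height x < f → a ⊑ x → fibreSum x ≡ 0ℤ
      go (suc f) x h a⊑x = begin
        fibreSum x
          ≡⟨ ∑ℤ.when-yes (x ⊑? x) ⊑-refl _ ⟨
        ∑ℤ.when (x ⊑? x) (fibreSum x)
          ≡⟨ ∑ℤ.sum-single {N} (λ y → ∑ℤ.when (y ⊑? x) (fibreSum y)) x other-fibres ⟨
        ∑ℤ.sum (λ y → ∑ℤ.when (y ⊑? x) (fibreSum y))
          ≡⟨ ∑ℤ.sum-cong-≋ {N} (λ y → ∑ℤ.sum-when {n = N} (y ⊑? x) _) ⟨
        ∑ℤ.sum (λ y → ∑ℤ.sum (λ z → ∑ℤ.when (y ⊑? x) (∑ℤ.when ((z ⊔ a) ≟ y) (μ₀ z))))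
          ≡⟨ ∑ℤ.∑-comm {N} {N} _ ⟩
        ∑ℤ.sum (λ z → ∑ℤ.sum (λ y → ∑ℤ.when (y ⊑? x) (∑ℤ.when ((z ⊔ a) ≟ y) (μ₀ z))))
          ≡⟨ ∑ℤ.sum-cong-≋ {N} fibre ⟩
        ∑ℤ.sum (λ z → ∑ℤ.when (z ⊑? x) (μ₀ z))
          ≡⟨ sum-μ₀-below x (λ { refl → 0≢a (antisym (minimum a) a⊑x) }) ⟩
        0ℤ ∎
        where
        -- For `a ⊑ y` this is the induction on height; otherwise the fibre is empty, as every
        -- `z ⊔ a` lies above `a`.
        other-fibres : ∀ y → y ≢ x → ∑ℤ.when (y ⊑? x) (fibreSum y) ≡ 0ℤ
        other-fibres y y≢x with y ⊑? x | a ⊑? y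
        ... | no _    | _       = refl
        ... | yes y⊑x | yes a⊑y = go f y (ℕ.<-≤-trans (height-< (y⊑x , y≢x)) (s≤s⁻¹ h)) a⊑y
        ... | yes _   | no a⋢y  = ∑ℤ.sum-zero {N} _ λ z →
          ∑ℤ.when-no ((z ⊔ a) ≟ y) (λ { refl → a⋢y (y≤x∨y z a) }) _

        fibre : ∀ z → ∑ℤ.sum (λ y → ∑ℤ.when (y ⊑? x) (∑ℤ.when ((z ⊔ a) ≟ y) (μ₀ z))) ≡ ∑ℤ.when (z ⊑? x) (μ₀ z)
        fibre z = begin
          ∑ℤ.sum (λ y → ∑ℤ.when (y ⊑? x) (∑ℤ.when ((z ⊔ a) ≟ y) (μ₀ z)))
            ≡⟨ ∑ℤ.sum-single {N} _ (z ⊔ a) (λ y y≢ → trans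
                 (∑ℤ.when-cong (y ⊑? x) λ _ → ∑ℤ.when-no ((z ⊔ a) ≟ y) (y≢ ∘ sym) (μ₀ z))
                 (when-zero (y ⊑? x))) ⟩
          ∑ℤ.when ((z ⊔ a) ⊑? x) (∑ℤ.when ((z ⊔ a) ≟ (z ⊔ a)) (μ₀ z))
            ≡⟨ ∑ℤ.when-cong ((z ⊔ a) ⊑? x) (λ _ → ∑ℤ.when-yes ((z ⊔ a) ≟ (z ⊔ a)) refl (μ₀ z)) ⟩
          ∑ℤ.when ((z ⊔ a) ⊑? x) (μ₀ z)
            ≡⟨ ∑ℤ.when-⇔ ((z ⊔ a) ⊑? x) (z ⊑? x) (⊑-trans (x≤x∨y z a)) (λ z⊑x → ∨-least z⊑x a⊑x) _ ⟩
          ∑ℤ.when (z ⊑? x) (μ₀ z) ∎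
          where
          when-zero : (d : Dec P) → ∑ℤ.when d 0ℤ ≡ 0ℤ
          when-zero (yes _) = refl
          when-zero (no _)  = refl

    -- For an atom `a`, these are the lattice complements of `a` in [0̂ , x]: given the join,
    -- `z ≢ x` says exactly that `a` is not below `z`.
    Complementary : Fin N → Fin N → Set
    Complementary x z = (z ⊔ a) ≡ x × z ≢ x

    complementary? : ∀ x z → Dec (Complementary x z)
    complementary? x z = ((z ⊔ a) ≟ x) ×-dec ¬? (z ≟ x)

    -- Since `a ⊑ x`, the fibre over `x` contains `x` itself; its term is moved to the other side of
    -- Weisner's identity.
    μ₀-complements : ∀ x → a ⊑ x →
      μ₀ x ≡ - ∑ℤ.sum (λ z → ∑ℤ.when (complementary? x z) (μ₀ z))
    μ₀-complements x a⊑x = inverseˡ-unique _ _ (trans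
      (sym (∑ℤ.sum-split {N} (λ z → (z ⊔ a) ≟ x) μ₀ x (antisym (∨-least ⊑-refl a⊑x) (x≤x∨y x a))))
      (weisner x a⊑x))

  -- Atoms, and the size of an atomistic lattice.

  isAtom? : ∀ a → Dec (IsAtom L a)
  isAtom? a = (0̂ ⊏? a) ×-dec Fin.all? λ z → (0̂ ⊑? z) →-dec ((z ⊑? a) →-dec ((z ≟ 0̂) ⊎-dec (z ≟ a)))

  atomCount : Fin N → ℕ
  atomCount x = count (λ a → isAtom? a ×-dec (a ⊑? x))

  atoms : List (Fin N)
  atoms = filter isAtom? (allFin N)

  length-atoms : length atoms ≤ atomCount 1̂
  length-atoms rewrite length-filter-tabulate {N} isAtom? id =
    sum-mono-≤ {N} λ a → when-⇒ (isAtom? a) (isAtom? a ×-dec (a ⊑? 1̂)) (_, maximum a)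

  subJoins : List (Fin N) → List (Fin N)
  subJoins []       = [ 0̂ ]
  subJoins (a ∷ as) = subJoins as ++ map (a ⊔_) (subJoins as)

  length-subJoins : ∀ as → length (subJoins as) ≡ 2 ^ length as
  length-subJoins []       = refl
  length-subJoins (a ∷ as) = begin
    length (subJoins as ++ map (a ⊔_) (subJoins as))
      ≡⟨ length-++ (subJoins as) ⟩
    length (subJoins as) + length (map (a ⊔_) (subJoins as))
      ≡⟨ cong₂ _+_ (length-subJoins as) (trans (length-map (a ⊔_) (subJoins as)) (length-subJoins as)) ⟩
    2 ^ length as + 2 ^ length as
      ≡⟨ cong (λ s → 2 ^ length as + s) (ℕ.+-identityʳ _) ⟨
    2 ^ length (a ∷ as) ∎
    where open ≡-Reasoning

  ⋁-filter∈subJoins : ∀ x as → ⋁ L (filter (_⊑? x) as) ∈ subJoins as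
  ⋁-filter∈subJoins x []       = here refl
  ⋁-filter∈subJoins x (a ∷ as) with a ⊑? x
  ... | yes _ = ∈-++⁺ʳ (subJoins as) (∈-map⁺ (a ⊔_) (⋁-filter∈subJoins x as))
  ... | no _  = ∈-++⁺ˡ (⋁-filter∈subJoins x as)

  ∈⇒⊑⋁ : ∀ {a as} → a ∈ as → a ⊑ ⋁ L as
  ∈⇒⊑⋁ (here refl) = x≤x∨y _ _
  ∈⇒⊑⋁ (there a∈)  = ⊑-trans (∈⇒⊑⋁ a∈) (y≤x∨y _ _)

  ⋁-least : ∀ {x} as → (∀ {a} → a ∈ as → a ⊑ x) → ⋁ L as ⊑ x
  ⋁-least []       h = minimum _
  ⋁-least (a ∷ as) h = ∨-least (h (here refl)) (⋁-least as (h ∘ there))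

  -- Every element is the join of all atoms below it, hence occurs among the joins of sublists of
  -- `atoms`.
  size≤2^atoms : Atomistic L → N ≤ 2 ^ length atoms
  size≤2^atoms atomistic = subst (N ≤_) (length-subJoins atoms) (covered⇒≤length (subJoins atoms) λ x →
    subst (_∈ subJoins atoms) (⋁-below x) (⋁-filter∈subJoins x atoms))
    where
    -- The join of all atoms below `x` cannot exceed `x`, and the atoms supplied by `atomistic` are
    -- among them.
    ⋁-below : ∀ x → ⋁ L (filter (_⊑? x) atoms) ≡ x
    ⋁-below x with atomistic x
    ... | as , as-atoms , refl = antisym
      (⋁-least _ (λ a∈ → proj₂ (∈-filter⁻ (_⊑? ⋁ L as) {xs = atoms} a∈)))
      (⋁-least as λ a∈as → ∈⇒⊑⋁ (∈-filter⁺ (_⊑? ⋁ L as)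
        (∈-filter⁺ isAtom? (∈-allFin _) (All.lookup as-atoms a∈as)) (∈⇒⊑⋁ a∈as)))

-- Signs, and rank in a geometric lattice.

sgn : ℕ → ℤ
sgn zero    = 1ℤ
sgn (suc n) = - sgn n

∣sgn∣ : ∀ n → ∣ sgn n ∣ ≡ 1
∣sgn∣ zero    = refl
∣sgn∣ (suc n) = trans (ℤ.∣-i∣≡∣i∣ (sgn n)) (∣sgn∣ n)

∣sgn*i∣ : ∀ n i → ∣ sgn n ℤ.* i ∣ ≡ ∣ i ∣
∣sgn*i∣ n i = trans (ℤ.abs-* (sgn n) i) (trans (cong (_* ∣ i ∣) (∣sgn∣ n)) (ℕ.*-identityˡ _))

module Geometric (L : FinLattice) {d : ℕ} (geometric : IsGeometricOfRank L d) where
  open FiniteLattice L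
  open FinLattice L using ()
    renaming (size to N; _≼_ to _⊑_; _≼?_ to _⊑?_; _∨_ to _⊔_; _∧_ to _⊓_; 𝟙 to 1̂; 𝟘 to 0̂; _≺_ to _⊏_)
  open IsBoundedLattice (isBoundedLattice L) using (x≤x∨y; y≤x∨y; ∨-least; antisym; minimum)
    renaming (refl to ⊑-refl; trans to ⊑-trans; reflexive to ⊑-reflexive)
  open IsGeometricOfRank geometric
    using (isRankFunction; semimodular; atomistic; rank-top) renaming (rank to r)

  -- Rank is prescribed only along covers, so an interval that is not a cover is split at an
  -- interior `w`, with a smaller height gap on both sides.
  rank-strict : ∀ {x y} → x ⊏ y → r x < r y
  rank-strict {x} {y} = go (suc (height y)) x y (ℕ.m≤n+m _ (height x))
    where
    -- `f` exceeds the height gap; at zero the bound contradicts `height-<`.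
    go : ∀ f x y → height y < height x + f → x ⊏ y → r x < r y
    go zero x y h x⊏y =
      contradiction (height-< x⊏y) (ℕ.<-asym (subst (height y <_) (ℕ.+-identityʳ _) h))
    go (suc f) x y h x⊏y with Fin.any? (λ w → (x ⊏? w) ×-dec (w ⊏? y))
    ... | yes (w , x⊏w , w⊏y) = ℕ.<-trans
      (go f x w (ℕ.<-≤-trans (height-< w⊏y) (s≤s⁻¹ h′)) x⊏w)
      (go f w y (ℕ.<-≤-trans h′ (ℕ.+-monoˡ-≤ f (height-< x⊏w))) w⊏y)
      where
      h′ : height y < suc (height x + f)
      h′ = subst (height y <_) (ℕ.+-suc _ f) h
    ... | no ∄w = ℕ.≤-reflexive (sym (proj₂ isRankFunction x y (x⊏y , covers)))
      where
      covers : ∀ z → x ⊑ z → z ⊑ y → z ≡ x ⊎ z ≡ y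
      covers z x⊑z z⊑y with z ≟ x | z ≟ y
      ... | yes z≡x | _       = inj₁ z≡x
      ... | no _    | yes z≡y = inj₂ z≡y
      ... | no z≢x  | no z≢y  = contradiction (z , (x⊑z , z≢x ∘ sym) , (z⊑y , z≢y)) ∄w

  rank-mono : ∀ {x y} → x ⊑ y → r x ≤ r y
  rank-mono {x} {y} x⊑y with x ≟ y
  ... | yes refl = ℕ.≤-refl
  ... | no x≢y   = ℕ.<⇒≤ (rank-strict (x⊑y , x≢y))

  rank-join-atom : ∀ {a} → IsAtom L a → ∀ z → r (z ⊔ a) ≤ suc (r z)
  rank-join-atom {a} atom z = begin
    r (z ⊔ a)             ≤⟨ ℕ.m≤m+n _ _ ⟩
    r (z ⊔ a) + r (z ⊓ a) ≤⟨ semimodular z a ⟩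
    r z + r a             ≡⟨ cong (λ s → r z + s) (proj₂ isRankFunction 0̂ a atom) ⟩
    r z + suc (r 0̂)       ≡⟨ cong (λ s → r z + suc s) (proj₁ isRankFunction) ⟩
    r z + 1               ≡⟨ ℕ.+-comm (r z) 1 ⟩
    suc (r z)             ∎
    where open ℕ.≤-Reasoning

  ⋢⇒⊏join : ∀ {z a} → ¬ (a ⊑ z) → z ⊏ (z ⊔ a)
  ⋢⇒⊏join {z} {a} a⋢z = x≤x∨y z a , λ z≡z⊔a → a⋢z (⊑-trans (y≤x∨y z a) (⊑-reflexive (sym z≡z⊔a)))

  -- Semimodularity gives one inequality and strictness the other. All terms of Weisner's sum thus
  -- have the same rank, one below `x`.
  rank-complementary : ∀ {a x z} (atom : IsAtom L a) →
    Complementary a (proj₂ (proj₁ atom)) x z → r x ≡ suc (r z)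
  rank-complementary {a} {x} {z} atom (refl , z≢x) =
    ℕ.≤-antisym (rank-join-atom atom z) (rank-strict (x≤x∨y z a , z≢x))

  -- If all atoms in a join representing `x` were below `w`, so would `x` be. Used with `w = 0̂` to
  -- find an atom, and with larger `w` to enlarge an element inside [0̂ , x].
  atom-below-not-below : ∀ {x w} → ¬ (x ⊑ w) → ∃ λ c → IsAtom L c × c ⊑ x × ¬ (c ⊑ w)
  atom-below-not-below {x} {w} x⋢w with atomistic x
  ... | as , as-atoms , refl = go as as-atoms x⋢w
    where
    go : ∀ as → All (IsAtom L) as → ¬ (⋁ L as ⊑ w) → ∃ λ c → IsAtom L c × c ⊑ ⋁ L as × ¬ (c ⊑ w)
    go []       []             h = contradiction (minimum w) h
    go (c ∷ as) (atom ∷ atoms) h with c ⊑? w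
    ... | no c⋢w  = c , atom , x≤x∨y _ _ , c⋢w
    ... | yes c⊑w with go as atoms (h ∘ ∨-least c⊑w)
    ...   | c′ , atom′ , c′⊑ , c′⋢w = c′ , atom′ , ⊑-trans c′⊑ (y≤x∨y _ _) , c′⋢w

  -- Complements of an atom, and the atoms below them.

  module _ {a x : Fin N} (atom : IsAtom L a) (a⊑x : a ⊑ x) where

    private
      Compl  = Complementary a (proj₂ (proj₁ atom)) x
      compl? = complementary? a (proj₂ (proj₁ atom)) x

    -- While `z ⊔ a` is not yet `x`, join to `z` an atom `c ⊑ x` that is not below `z ⊔ a`. This
    -- keeps `a` avoided and raises the rank, which is bounded by `r x`.
    complement-above : ∀ {z} → z ⊑ x → ¬ (a ⊑ z) → ∃ λ z′ → z ⊑ z′ × Compl z′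
    complement-above {z} = go (suc (r x)) z (ℕ.m≤n+m _ (r z))
      where
      go : ∀ f z → r x < r z + f → z ⊑ x → ¬ (a ⊑ z) → ∃ λ z′ → z ⊑ z′ × Compl z′
      go zero z h z⊑x _ =
        contradiction (rank-mono z⊑x) (ℕ.<⇒≱ (subst (r x <_) (ℕ.+-identityʳ _) h))
      go (suc f) z h z⊑x a⋢z with (z ⊔ a) ≟ x
      ... | yes eq = z , ⊑-refl , eq , λ { refl → a⋢z a⊑x }
      ... | no z⊔a≢x
        with atom-below-not-below (λ x⊑z⊔a → z⊔a≢x (antisym (∨-least z⊑x a⊑x) x⊑z⊔a))
      ...   | c , c-atom , c⊑x , c⋢z⊔a
        with go f (z ⊔ c) (ℕ.<-≤-trans h′ (ℕ.+-monoˡ-≤ f (rank-strict z⊏z⊔c))) (∨-least z⊑x c⊑x) a⋢z⊔c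
        where
        h′ : r x < suc (r z + f)
        h′ = subst (r x <_) (ℕ.+-suc _ f) h
        z⊏z⊔c : z ⊏ (z ⊔ c)
        z⊏z⊔c = ⋢⇒⊏join (λ c⊑z → c⋢z⊔a (⊑-trans c⊑z (x≤x∨y z a)))
        a⋢z⊔c : ¬ (a ⊑ (z ⊔ c))
        -- Exchange: otherwise `z ⊏ z ⊔ a ⊏ z ⊔ c` would raise the rank by two, while the atom `c`
        -- raises it by at most one.
        a⋢z⊔c a⊑z⊔c = ℕ.<⇒≱ (rank-strict (∨-least (x≤x∨y z c) a⊑z⊔c , z⊔a≢z⊔c))
          (ℕ.≤-trans (rank-join-atom c-atom z) (rank-strict (⋢⇒⊏join a⋢z)))
          where
          z⊔a≢z⊔c : (z ⊔ a) ≢ (z ⊔ c)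
          z⊔a≢z⊔c eq = c⋢z⊔a (⊑-trans (y≤x∨y z c) (⊑-reflexive (sym eq)))
      ...     | z′ , z⊔c⊑z′ , compl = z′ , ⊑-trans (x≤x∨y z c) z⊔c⊑z′ , compl

    -- An atom below `x` is `a` or lies below some complement; it may lie below several, whence an
    -- inequality.
    atomCount-complements : atomCount x ≤ 1 + ∑ℕ.sum (λ z → ∑ℕ.when (compl? z) (atomCount z))
    atomCount-complements = begin
      atomCount x
        ≤⟨ sum-mono-≤ {N} bound ⟩
      ∑ℕ.sum (λ c → ∑ℕ.when (c ≟ a) 1 + ∑ℕ.sum (λ z → ∑ℕ.when (compl? z) (under z c)))
        ≡⟨ ∑ℕ.∑-distrib-+ {N} _ _ ⟩
      ∑ℕ.sum (λ c → ∑ℕ.when (c ≟ a) 1) + ∑ℕ.sum (λ c → ∑ℕ.sum (λ z → ∑ℕ.when (compl? z) (under z c)))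
        ≡⟨ cong₂ _+_ (trans (∑ℕ.sum-single {N} _ a (λ c c≢a → ∑ℕ.when-no (c ≟ a) c≢a 1)) (∑ℕ.when-yes (a ≟ a) refl 1))
                     (trans (∑ℕ.∑-comm {N} {N} _) (∑ℕ.sum-cong-≋ {N} (λ z → ∑ℕ.sum-when {n = N} (compl? z) (under z)))) ⟩
      1 + ∑ℕ.sum (λ z → ∑ℕ.when (compl? z) (atomCount z)) ∎
      where
      open ℕ.≤-Reasoning
      under : Fin N → Fin N → ℕ
      under z c = ∑ℕ.when (isAtom? c ×-dec (c ⊑? z)) 1

      bound : ∀ c → under x c ≤ ∑ℕ.when (c ≟ a) 1 + ∑ℕ.sum (λ z → ∑ℕ.when (compl? z) (under z c))
      bound c = case (c ≟ a) ,′ (isAtom? c ×-dec (c ⊑? x)) of λ where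
        (_ , no ¬p) → ℕ.≤-trans (ℕ.≤-reflexive (∑ℕ.when-no (isAtom? c ×-dec (c ⊑? x)) ¬p 1)) z≤n
        (yes c≡a , _) → ℕ.≤-trans (when-⇒ (isAtom? c ×-dec (c ⊑? x)) (c ≟ a) (λ _ → c≡a)) (ℕ.m≤m+n _ _)
        -- Distinct atoms are incomparable, so `c` avoids `a` and can be enlarged to a complement.
        (no c≢a , yes (c-atom , c⊑x)) → case complement-above c⊑x (λ a⊑c →
            case proj₂ c-atom a (minimum a) a⊑c of λ where
              (inj₁ a≡0) → proj₂ (proj₁ atom) (sym a≡0)
              (inj₂ a≡c) → c≢a (sym a≡c)) of λ (z , c⊑z , compl) → begin
          under x c
            ≤⟨ when-⇒ (isAtom? c ×-dec (c ⊑? x)) (isAtom? c ×-dec (c ⊑? z)) (λ _ → c-atom , c⊑z) ⟩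
          under z c
            ≡⟨ ∑ℕ.when-yes (compl? z) compl _ ⟨
          ∑ℕ.when (compl? z) (under z c)
            ≤⟨ term≤sum {N} (λ z → ∑ℕ.when (compl? z) (under z c)) z ⟩
          ∑ℕ.sum (λ z → ∑ℕ.when (compl? z) (under z c))
            ≤⟨ ℕ.m≤n+m _ _ ⟩
          ∑ℕ.when (c ≟ a) 1 + ∑ℕ.sum (λ z → ∑ℕ.when (compl? z) (under z c)) ∎

  -- The induction on rank.

  record MöbiusBound (n : ℕ) (x : Fin N) : Set where
    field
      alternates : μ₀ x ≡ sgn n ℤ.* + ∣ μ₀ x ∣
      nonzero    : 1 ≤ ∣ μ₀ x ∣
      fewAtoms   : atomCount x ≤ n * ∣ μ₀ x ∣
  open MöbiusBound

  -- The three claims are proved together: `alternates` excludes cancellation in Weisner's sum, and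
  -- `nonzero` lets the extra atom be absorbed in `fewAtoms`.
  möbiusBound : ∀ n x → r x ≡ n → MöbiusBound n x
  möbiusBound zero x rx≡0 with 0̂ ≟ x
  ... | no 0≢x   = contradiction (subst (r 0̂ <_) rx≡0 (rank-strict (minimum x , 0≢x))) λ ()
  ... | yes refl = record
    { alternates = trans μ₀-0̂ (sym (cong (λ i → 1ℤ ℤ.* + ∣ i ∣) μ₀-0̂))
    ; nonzero    = ℕ.≤-reflexive (sym (cong ∣_∣ μ₀-0̂))
    ; fewAtoms   = ℕ.≤-reflexive (∑ℕ.sum-zero {N} _ λ c → ∑ℕ.when-no (isAtom? c ×-dec (c ⊑? 0̂))
        (λ (atom , c⊑0) → proj₂ (proj₁ atom) (antisym (minimum c) c⊑0)) 1)
    }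
  möbiusBound (suc n) x rx≡1+n = record
    { alternates = trans μ₀x≡ (cong (λ s → sgn (suc n) ℤ.* + s) (sym ∣μ₀x∣≡K))
    ; nonzero    = subst (1 ≤_) (sym ∣μ₀x∣≡K) 1≤K
    ; fewAtoms   = subst (λ s → atomCount x ≤ suc n * s) (sym ∣μ₀x∣≡K) few
    }
    where
    x⋢0 : ¬ (x ⊑ 0̂)
    x⋢0 x⊑0 = contradiction (subst (_≤ r 0̂) rx≡1+n (rank-mono x⊑0))
      (ℕ.<⇒≱ (subst (_< suc n) (sym (proj₁ isRankFunction)) (s≤s z≤n)))

    an-atom = atom-below-not-below x⋢0
    a    = proj₁ an-atom
    atom = proj₁ (proj₂ an-atom)
    a⊑x  = proj₁ (proj₂ (proj₂ an-atom))
    a⋢0  = proj₂ (proj₂ (proj₂ an-atom))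
    compl? = complementary? a (proj₂ (proj₁ atom)) x

    IH : ∀ {z} → Complementary a (proj₂ (proj₁ atom)) x z → MöbiusBound n z
    IH {z} compl = möbiusBound n z (ℕ.suc-injective (trans (sym (rank-complementary atom compl)) rx≡1+n))

    -- This will be the absolute value of `μ₀ x`, as all terms of Weisner's sum have the same sign.
    K : ℕ
    K = ∑ℕ.sum (λ z → ∑ℕ.when (compl? z) ∣ μ₀ z ∣)

    μ₀x≡ : μ₀ x ≡ sgn (suc n) ℤ.* + K
    μ₀x≡ = begin
      μ₀ x
        ≡⟨ μ₀-complements a (proj₂ (proj₁ atom)) x a⊑x ⟩
      - ∑ℤ.sum (λ z → ∑ℤ.when (compl? z) (μ₀ z))
        ≡⟨ cong -_ (∑ℤ.sum-cong-≋ {N} (λ z → ∑ℤ.when-cong (compl? z) (alternates ∘ IH))) ⟩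
      - ∑ℤ.sum (λ z → ∑ℤ.when (compl? z) (sgn n ℤ.* + ∣ μ₀ z ∣))
        ≡⟨ cong -_ (∑ℤ.sum-when-* {N} compl? (sgn n) _) ⟩
      - (sgn n ℤ.* ∑ℤ.sum (λ z → ∑ℤ.when (compl? z) (+ ∣ μ₀ z ∣)))
        ≡⟨ cong (λ s → - (sgn n ℤ.* s)) (trans (∑ℤ.sum-cong-≋ {N} (λ z → pos-when (compl? z) _)) (pos-sum {N} _)) ⟩
      - (sgn n ℤ.* + K)
        ≡⟨ ℤ.neg-distribˡ-* (sgn n) (+ K) ⟩
      sgn (suc n) ℤ.* + K ∎
      where open ≡-Reasoning

    ∣μ₀x∣≡K : ∣ μ₀ x ∣ ≡ K
    ∣μ₀x∣≡K = trans (cong ∣_∣ μ₀x≡) (∣sgn*i∣ (suc n) (+ K))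

    1≤K : 1 ≤ K
    -- Enlarging `0̂` to a complement shows that the sum has a term.
    1≤K = case complement-above atom a⊑x (minimum x) a⋢0 of λ (z , _ , compl) → begin
      1                              ≤⟨ nonzero (IH compl) ⟩
      ∣ μ₀ z ∣                       ≡⟨ ∑ℕ.when-yes (compl? z) compl _ ⟨
      ∑ℕ.when (compl? z) ∣ μ₀ z ∣    ≤⟨ term≤sum {N} (λ z → ∑ℕ.when (compl? z) ∣ μ₀ z ∣) z ⟩
      K                              ∎
      where open ℕ.≤-Reasoning

    few : atomCount x ≤ suc n * K
    few = begin
      atomCount x
        ≤⟨ atomCount-complements atom a⊑x ⟩
      1 + ∑ℕ.sum (λ z → ∑ℕ.when (compl? z) (atomCount z))
        -- The 1 counting `a` is replaced by a whole `K`, which turns the factor `n` into `suc n`.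
        ≤⟨ ℕ.+-mono-≤ 1≤K (sum-mono-≤ {N} λ z → when-mono-≤ (compl? z) (fewAtoms ∘ IH)) ⟩
      K + ∑ℕ.sum (λ z → ∑ℕ.when (compl? z) (n * ∣ μ₀ z ∣))
        ≡⟨ cong (λ s → K + s) (∑ℕ.sum-when-* {N} compl? n _) ⟩
      suc n * K ∎
      where open ℕ.≤-Reasoning

  size-bound : N ≤ 2 ^ (d * ∣ μ L 0̂ 1̂ ∣)
  size-bound = ℕ.≤-trans (size≤2^atoms atomistic)
    (ℕ.^-monoʳ-≤ 2 (ℕ.≤-trans length-atoms (fewAtoms (möbiusBound d 1̂ rank-top))))

-- Enumeration of the lattices of a given size.

allVecs : {A : Set} → List A → ∀ n → List (Vec A n)
allVecs xs zero    = [ [] ]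
allVecs xs (suc n) = cartesianProductWith _∷_ xs (allVecs xs n)

∈-allVecs : {A : Set} {xs : List A} → (∀ x → x ∈ xs) → ∀ {n} (v : Vec A n) → v ∈ allVecs xs n
∈-allVecs all∈ []      = here refl
∈-allVecs all∈ (x ∷ v) = ∈-cartesianProductWith⁺ _∷_ (all∈ x) (∈-allVecs all∈ v)

∈-bools : ∀ b → b ∈ (true ∷ false ∷ [])
∈-bools true  = here refl
∈-bools false = there (here refl)

HasSuprema : (Fin n → Fin n → Set) → Set
HasSuprema _≤_ = ∀ x y → ∃ λ s → x ≤ s × y ≤ s × (∀ z → x ≤ z → y ≤ z → s ≤ z)

-- Joins, meets and bounds are existential statements about the order alone, which makes the
-- property decidable over `Fin n`.
IsLatticeOrder : (Fin n → Fin n → Set) → Set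
IsLatticeOrder _≤_ =
  (∀ x → x ≤ x) × (∀ x y → x ≤ y → y ≤ x → x ≡ y) × (∀ x y z → x ≤ y → y ≤ z → x ≤ z) ×
  HasSuprema _≤_ × HasSuprema (flip _≤_) × (∃ λ t → ∀ x → x ≤ t) × (∃ λ b → ∀ x → b ≤ x)

module _ {_≤_ : Fin n → Fin n → Set} (_≤?_ : ∀ x y → Dec (x ≤ y)) where

  isLatticeOrder? : Dec (IsLatticeOrder _≤_)
  isLatticeOrder? =
    Fin.all? (λ x → x ≤? x) ×-dec
    Fin.all? (λ x → Fin.all? λ y → (x ≤? y) →-dec ((y ≤? x) →-dec (x ≟ y))) ×-dec
    Fin.all? (λ x → Fin.all? λ y → Fin.all? λ z → (x ≤? y) →-dec ((y ≤? z) →-dec (x ≤? z))) ×-dec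
    hasSuprema? _≤?_ ×-dec
    hasSuprema? (flip _≤?_) ×-dec
    Fin.any? (λ t → Fin.all? λ x → x ≤? t) ×-dec
    Fin.any? (λ b → Fin.all? λ x → b ≤? x)
    where
    hasSuprema? : {_⊴_ : Fin n → Fin n → Set} → (∀ x y → Dec (x ⊴ y)) → Dec (HasSuprema _⊴_)
    hasSuprema? _⊴?_ = Fin.all? λ x → Fin.all? λ y → Fin.any? λ s →
      (x ⊴? s) ×-dec (y ⊴? s) ×-dec Fin.all? λ z → (x ⊴? z) →-dec ((y ⊴? z) →-dec (s ⊴? z))

  fromOrder : IsLatticeOrder _≤_ → FinLattice
  fromOrder (≤-refl , ≤-antisym , ≤-trans , sup , inf , (t , ≤t) , (b , b≤)) = record
    { size = n
    ; _≼_  = _≤_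
    ; _≼?_ = _≤?_
    ; _∨_  = λ x y → proj₁ (sup x y)
    ; _∧_  = λ x y → proj₁ (inf x y)
    ; 𝟙    = t
    ; 𝟘    = b
    ; isBoundedLattice = record
      { isLattice = record
        { isPartialOrder = record
          { isPreorder = record
            { isEquivalence = isEquivalence
            ; reflexive     = λ { refl → ≤-refl _ }
            ; trans         = ≤-trans _ _ _
            }
          ; antisym = ≤-antisym _ _
          }
        ; supremum = λ x y → proj₂ (sup x y)
        ; infimum  = λ x y → proj₂ (inf x y)
        }
      ; maximum = ≤t
      ; minimum = b≤
      }
    }

-- A relation is coded by its truth table: there are finitely many Boolean matrices, and they can be
-- listed.
Entry : Vec (Vec Bool n) n → Fin n → Fin n → Set
Entry M x y = T (lookup (lookup M x) y)

entry? : (M : Vec (Vec Bool n) n) → ∀ x y → Dec (Entry M x y)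
entry? M x y = T? (lookup (lookup M x) y)

fromMatrix : Vec (Vec Bool n) n → List FinLattice
fromMatrix M with isLatticeOrder? (entry? M)
... | yes lattice = [ fromOrder (entry? M) lattice ]
... | no _        = []

latticesOfSize : ℕ → List FinLattice
latticesOfSize n = concatMap fromMatrix (allVecs (allVecs (true ∷ false ∷ []) n) n)

module _ (L : FinLattice) where
  open FinLattice L using () renaming (size to N; _≼_ to _⊑_; _≼?_ to _⊑?_)
  open IsBoundedLattice (isBoundedLattice L)
    using (supremum; infimum; antisym; minimum; maximum) renaming (refl to ⊑-refl; trans to ⊑-trans)

  matrix : Vec (Vec Bool N) N
  matrix = Vec.tabulate λ x → Vec.tabulate λ y → ⌊ x ⊑? y ⌋

  lookup-matrix : ∀ x y → lookup (lookup matrix x) y ≡ ⌊ x ⊑? y ⌋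
  lookup-matrix x y = trans (cong (λ row → lookup row y) (lookup∘tabulate _ x)) (lookup∘tabulate _ y)

  ⊑⇒entry : ∀ {x y} → x ⊑ y → Entry matrix x y
  ⊑⇒entry {x} {y} x⊑y rewrite lookup-matrix x y = fromWitness x⊑y

  entry⇒⊑ : ∀ {x y} → Entry matrix x y → x ⊑ y
  entry⇒⊑ {x} {y} e rewrite lookup-matrix x y = toWitness e

  matrix-isLatticeOrder : IsLatticeOrder (Entry matrix)
  matrix-isLatticeOrder =
    (λ x → ⊑⇒entry ⊑-refl) ,
    (λ x y e e′ → antisym (entry⇒⊑ e) (entry⇒⊑ e′)) ,
    (λ x y z e e′ → ⊑⇒entry (⊑-trans (entry⇒⊑ e) (entry⇒⊑ e′))) ,
    (λ x y → let (x⊑s , y⊑s , least) = supremum x y in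
      _ , ⊑⇒entry x⊑s , ⊑⇒entry y⊑s , λ z e e′ → ⊑⇒entry (least z (entry⇒⊑ e) (entry⇒⊑ e′))) ,
    (λ x y → let (i⊑x , i⊑y , greatest) = infimum x y in
      _ , ⊑⇒entry i⊑x , ⊑⇒entry i⊑y , λ z e e′ → ⊑⇒entry (greatest z (entry⇒⊑ e) (entry⇒⊑ e′))) ,
    (_ , λ x → ⊑⇒entry (maximum x)) ,
    (_ , λ x → ⊑⇒entry (minimum x))

  -- `_≅_` compares orders, and the lattice rebuilt from the truth table has the same carrier and an
  -- equivalent order, so the identity serves.
  ≅-fromMatrix : Any (L ≅_) (fromMatrix matrix)
  ≅-fromMatrix with isLatticeOrder? (entry? matrix)
  ... | yes _ = here (record
    { bij       = ⤖-id _
    ; preserves = λ x y → ⊑⇒entry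
    ; reflects  = λ x y → entry⇒⊑
    })
  ... | no ¬lattice = contradiction matrix-isLatticeOrder ¬lattice

  ≅-latticesOfSize : Any (L ≅_) (latticesOfSize N)
  ≅-latticesOfSize = concatMap⁺ fromMatrix
    (lose (∈-allVecs (∈-allVecs ∈-bools) matrix) ≅-fromMatrix)

theorem5p1 : (d k : ℕ) → 1 ≤ d → 1 ≤ k →
    Σ (List FinLattice) λ reps →
    (L : FinLattice) → IsGeometricOfRank L d → ∣ μ L (𝟘 L) (𝟙 L) ∣ ≡ k →
    Any (λ M → L ≅ M) reps
-- The size bound depends on `d` and `k` only, so all lattices up to that size are listed, geometric
-- or not; `suc` because `upTo` omits its end point.
theorem5p1 d k _ _ = concatMap latticesOfSize (upTo (suc (2 ^ (d * k)))) , λ { L geometric refl →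
  concatMap⁺ latticesOfSize (lose (∈-upTo⁺ (s≤s (Geometric.size-bound L geometric))) (≅-latticesOfSize L)) }
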